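{- For every $\Delta^0_2$ set $X$ with $\emptyset'\not\leq_T X$, there exists a $\Delta^0_2$ function $f:\omega\to\omega$ such that $X$ computes no function $g:\omega\to\omega$ with $g(x)\neq f(x)$ for all $x\in\omega$.
   Context: A set or function is $\Delta^0_2$ if it is computable from $\emptyset'$. A function $g$ with $g(x)\neq f(x)$ for all $x$ is called $f$-diagonalizing. -}

module Defs where

open import Data.Nat using (ℕ; zero; suc; _+_; _*_; _<_)
open import Data.Product using (_×_; _,_; proj₁; proj₂; ∃; ∃-syntax)
open import Data.Sum using (_⊎_)
open import Level using (0ℓ)
open import Relation.Binary.Core using (Rel)
open import Relation.Binary.PropositionalEquality using (_≡_; _≢_)
open import Relation.Nullary using (¬_)
open import Relation.Unary using (Pred; ∅)

-- Cantor's bijection ℕ × ℕ → ℕ, enumerating (0,0), (1,0), (0,1), (2,0), (1,1), …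

triangle : ℕ → ℕ
triangle zero    = 0
triangle (suc n) = suc n + triangle n

⟨_,_⟩ : ℕ → ℕ → ℕ
⟨ x , y ⟩ = triangle (x + y) + y

unpair : ℕ → ℕ × ℕ
unpair zero = 0 , 0
unpair (suc n) with unpair n
... | zero  , y = suc y , 0
... | suc x , y = x , suc y

-- Programs for the unary partial functions that are recursive in an oracle;
-- functions of several arguments are represented through pairing.

data Code : Set where
  zero′ succ left right oracle : Code
  pair comp prec               : Code → Code → Code
  rfind                        : Code → Code

-- A partial function is represented by its graph.

Graph : Set₁
Graph = Rel ℕ 0ℓ

-- The characteristic function of a set.

χ : Pred ℕ 0ℓ → Graph
χ X n y = (X n × y ≡ 1) ⊎ ((¬ X n) × y ≡ 0)

-- h(a,0) = F(a),  h(a,n+1) = G(a,n,h(a,n))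

primRec : (F G : Graph) → ℕ → ℕ → ℕ → Set
primRec F G a zero    y = F a y
primRec F G a (suc n) y = ∃[ r ] (primRec F G a n r × G ⟨ a , ⟨ n , r ⟩ ⟩ y)

-- ⟦ c ⟧ X x y : program c with oracle X halts on input x with output y.
-- In the last clause, the search for the least zero requires all earlier
-- values to be defined and nonzero.

⟦_⟧ : Code → Pred ℕ 0ℓ → Graph
⟦ zero′    ⟧ X x y = y ≡ 0
⟦ succ     ⟧ X x y = y ≡ suc x
⟦ left     ⟧ X x y = y ≡ proj₁ (unpair x)
⟦ right    ⟧ X x y = y ≡ proj₂ (unpair x)
⟦ oracle   ⟧ X x y = χ X x y
⟦ pair c d ⟧ X x y = ∃[ u ] ∃[ v ] (⟦ c ⟧ X x u × ⟦ d ⟧ X x v × y ≡ ⟨ u , v ⟩)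
⟦ comp c d ⟧ X x y = ∃[ u ] (⟦ d ⟧ X x u × ⟦ c ⟧ X u y)
⟦ prec c d ⟧ X x y = primRec (⟦ c ⟧ X) (⟦ d ⟧ X) (proj₁ (unpair x)) (proj₂ (unpair x)) y
⟦ rfind c  ⟧ X x y = ⟦ c ⟧ X ⟨ x , y ⟩ 0 ×
                     (∀ z → z < y → ∃[ w ] ⟦ c ⟧ X ⟨ x , z ⟩ (suc w))

-- A Gödel numbering of programs. It is a bijection Code → ℕ: the five atoms
-- take 0,…,4 and the four compound forms take the residue classes mod 4
-- from 5 on.

encode : Code → ℕ
encode zero′      = 0
encode succ       = 1
encode left       = 2
encode right      = 3
encode oracle     = 4
encode (pair c d) = 5 + 4 * ⟨ encode c , encode d ⟩
encode (comp c d) = 6 + 4 * ⟨ encode c , encode d ⟩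
encode (prec c d) = 7 + 4 * ⟨ encode c , encode d ⟩
encode (rfind c)  = 8 + 4 * encode c

-- The Turing jump X′ = { e | Φₑ^X(e)↓ }, where Φₑ is the program numbered e.

jump : Pred ℕ 0ℓ → Pred ℕ 0ℓ
jump X e = ∃[ c ] (encode c ≡ e × ∃[ y ] ⟦ c ⟧ X e y)

∅′ : Pred ℕ 0ℓ
∅′ = jump ∅

-- A function is computable from X if some program with oracle X computes it.

_ComputableFrom_ : (ℕ → ℕ) → Pred ℕ 0ℓ → Set
f ComputableFrom X = ∃[ c ] (∀ x → ⟦ c ⟧ X x (f x))

-- Turing reducibility: some program with oracle X computes the
-- characteristic function of A.

_≤T_ : Pred ℕ 0ℓ → Pred ℕ 0ℓ → Set
A ≤T X = ∃[ c ] (∀ n → ∃[ y ] (⟦ c ⟧ X n y × χ A n y))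

Δ⁰₂-Set : Pred ℕ 0ℓ → Set
Δ⁰₂-Set X = X ≤T ∅′

Δ⁰₂-Function : (ℕ → ℕ) → Set
Δ⁰₂-Function f = f ComputableFrom ∅′

_IsDiagonalizingFor_ : (ℕ → ℕ) → (ℕ → ℕ) → Set
g IsDiagonalizingFor f = ∀ x → g x ≢ f x

{-# OPTIONS --safe #-}

-- Let f(⟨e,n⟩) be the value found by Φₑ^X(⟨e,n⟩) within s steps, where s is a
-- number of steps in which Φₙ(n) halts if n ∈ ∅′; this f is computable from
-- ∅′. If g = Φₑ^X differs from f everywhere, then for every n ∈ ∅′ the
-- computation Φₑ^X(⟨e,n⟩) takes more steps than Φₙ(n). Hence X decides ∅′ by
-- running Φₙ(n) for as long as Φₑ^X(⟨e,n⟩) runs. Steps are counted on an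
-- abstract machine whose step function, on codes of states, is itself
-- computed by a program.

module Submission where

open import Defs
open import Axiom.ExcludedMiddle using (ExcludedMiddle)
open import Data.Fin using (toℕ) renaming (zero to 0F; suc to sucF)
open import Data.List using (List; []; _∷_)
open import Data.Nat using (ℕ; zero; suc; pred; _+_; _*_; _∸_; _≤_; _<_; z≤n; s≤s)
open import Data.Nat.DivMod using (_divMod_; result)
open import Data.Nat.GeneralisedArithmetic using (fold; fold-+)
open import Data.Nat.Induction using (<-rec)
open import Data.Nat.Properties
open import Data.Product using (_×_; _,_; proj₁; proj₂; ∃-syntax)
open import Data.Sum using (inj₁; inj₂; [_,_]′)
open import Function using (_∘_; id)
open import Level using (0ℓ)
open import Relation.Binary.PropositionalEquality
open import Relation.Nullary using (¬_; yes; no; contradiction)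
open import Relation.Unary using (Pred; ∅)

private
  variable
    X : Pred ℕ 0ℓ

-- Cantor's bijection and the surjectivity of the Gödel numbering

⟨,suc⟩ : ∀ x y → ⟨ x , suc y ⟩ ≡ suc ⟨ suc x , y ⟩
⟨,suc⟩ x y rewrite +-suc x y = +-suc _ y

⟨suc,0⟩ : ∀ x → ⟨ suc x , 0 ⟩ ≡ suc ⟨ 0 , x ⟩
⟨suc,0⟩ x rewrite +-identityʳ x | +-identityʳ (x + triangle x) = cong suc (+-comm x _)

unpair-suc-row : ∀ {n y} → unpair n ≡ (0 , y) → unpair (suc n) ≡ (suc y , 0)
unpair-suc-row {n} eq with unpair n | eq
... | _ | refl = refl

unpair-suc-step : ∀ {n x y} → unpair n ≡ (suc x , y) → unpair (suc n) ≡ (x , suc y)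
unpair-suc-step {n} eq with unpair n | eq
... | _ | refl = refl

unpair-⟨,⟩ : ∀ x y → unpair ⟨ x , y ⟩ ≡ (x , y)
unpair-⟨,⟩ x y = go (x + y) y x refl
  where
  -- Lexicographic induction on the diagonal `s` and then on `y`: within a diagonal `y` drops, and
  -- from `y = 0` the predecessor is the end of the previous diagonal.
  go : ∀ s y x → x + y ≡ s → unpair ⟨ x , y ⟩ ≡ (x , y)
  go s       (suc y) x       eq =
    trans (cong unpair (⟨,suc⟩ x y))
          (unpair-suc-step {⟨ suc x , y ⟩} (go s y (suc x) (trans (sym (+-suc x y)) eq)))
  go zero    zero    zero    eq = refl
  go (suc s) zero    (suc x) eq =
    trans (cong unpair (⟨suc,0⟩ x))
          (unpair-suc-row {⟨ 0 , x ⟩} (go s x zero (trans (sym (+-identityʳ x)) (suc-injective eq))))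

⟨unpair⟩ : ∀ n → ⟨ proj₁ (unpair n) , proj₂ (unpair n) ⟩ ≡ n
⟨unpair⟩ zero = refl
⟨unpair⟩ (suc n) with unpair n | ⟨unpair⟩ n
... | zero  , y | eq = trans (⟨suc,0⟩ y) (cong suc eq)
... | suc x , y | eq = trans (⟨,suc⟩ x y) (cong suc eq)

n≤triangle : ∀ n → n ≤ triangle n
n≤triangle zero    = z≤n
n≤triangle (suc n) = m≤m+n (suc n) _

x≤⟨x,y⟩ : ∀ x y → x ≤ ⟨ x , y ⟩
x≤⟨x,y⟩ x y = ≤-trans (m≤m+n x y) (≤-trans (n≤triangle (x + y)) (m≤m+n _ y))

y≤⟨x,y⟩ : ∀ x y → y ≤ ⟨ x , y ⟩
y≤⟨x,y⟩ x y = m≤n+m y _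

-- Lets an arbitrary `n` be treated as `encode c`, so membership in `∅′` can be tested by running
-- the number `n`. After subtracting 5, the remainder mod 4 selects the compound constructor and the
-- quotient carries its arguments, which are smaller.
encode-surjective : ∀ n → ∃[ c ] encode c ≡ n
encode-surjective = <-rec _ go
  where
  bound : ∀ {m q} k r → m ≤ q → m < k + suc (r + q * 4)
  bound {m} {q} k r m≤q = ≤-trans (s≤s (≤-trans m≤q (≤-trans (m≤m*n q 4) (m≤n+m _ r)))) (m≤n+m _ k)

  go : ∀ n → (∀ {m} → m < n → ∃[ c ] encode c ≡ m) → ∃[ c ] encode c ≡ n
  go 0 rec = zero′ , refl
  go 1 rec = succ , refl
  go 2 rec = left , refl
  go 3 rec = right , refl
  go 4 rec = oracle , refl
  go (suc (suc (suc (suc (suc m))))) rec with m divMod 4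
  ... | result q r refl = node r (rec (bound 4 _ ≤-refl)) (rec (bound 4 _ u≤q)) (rec (bound 4 _ v≤q))
    where
    u v : ℕ
    u = proj₁ (unpair q)
    v = proj₂ (unpair q)

    u≤q : u ≤ q
    u≤q = subst (u ≤_) (⟨unpair⟩ q) (x≤⟨x,y⟩ u v)

    v≤q : v ≤ q
    v≤q = subst (v ≤_) (⟨unpair⟩ q) (y≤⟨x,y⟩ u v)

    compound : ∀ {x y} k → x ≡ u → y ≡ v → k + 4 * ⟨ x , y ⟩ ≡ k + q * 4
    compound k p e =
      cong (k +_) (trans (cong (4 *_) (trans (cong₂ ⟨_,_⟩ p e) (⟨unpair⟩ q))) (*-comm 4 q))

    node : ∀ r → ∃[ c ] encode c ≡ q → ∃[ c ] encode c ≡ u → ∃[ d ] encode d ≡ v →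
           ∃[ c ] encode c ≡ 5 + (toℕ r + q * 4)
    node 0F _ (c , p) (d , e) = pair c d , compound 5 p e
    node (sucF 0F) _ (c , p) (d , e) = comp c d , compound 6 p e
    node (sucF (sucF 0F)) _ (c , p) (d , e) = prec c d , compound 7 p e
    node (sucF (sucF (sucF 0F))) (c , p) _ _ =
      rfind c , cong (8 +_) (trans (cong (4 *_) p) (*-comm 4 q))

-- Opaque copies of the pairing functions: otherwise ⟨ suc x , y ⟩ unfolds to
-- triangular numbers in every goal.

opaque
  pr : ℕ → ℕ → ℕ
  pr = ⟨_,_⟩

  L R : ℕ → ℕ
  L = proj₁ ∘ unpair
  R = proj₂ ∘ unpair

  L-pr : ∀ x y → L (pr x y) ≡ x
  L-pr x y = cong proj₁ (unpair-⟨,⟩ x y)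

  R-pr : ∀ x y → R (pr x y) ≡ y
  R-pr x y = cong proj₂ (unpair-⟨,⟩ x y)

  id-computable : id ComputableFrom X
  id-computable = pair left right , λ x → _ , _ , refl , refl , sym (⟨unpair⟩ x)

  L-computable : L ComputableFrom X
  L-computable = left , λ _ → refl

  R-computable : R ComputableFrom X
  R-computable = right , λ _ → refl

  pr-computable : ∀ {f g} → f ComputableFrom X → g ComputableFrom X →
                  (λ x → pr (f x) (g x)) ComputableFrom X
  pr-computable (c , p) (d , q) = pair c d , λ x → _ , _ , p x , q x , refl

-- Closure properties of the functions computable from an oracle

infixr 9 _∘-computable_

_∘-computable_ : ∀ {f g} → f ComputableFrom X → g ComputableFrom X →
                 (λ x → f (g x)) ComputableFrom X
(c , p) ∘-computable (d , q) = comp c d , λ x → _ , q x , p _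

computable-cong : ∀ {f g} → (∀ x → f x ≡ g x) → f ComputableFrom X → g ComputableFrom X
computable-cong {X} eq (c , p) = c , λ x → subst (⟦ c ⟧ X x) (eq x) (p x)

suc-computable : suc ComputableFrom X
suc-computable = succ , λ _ → refl

const-computable : ∀ k → (λ _ → k) ComputableFrom X
const-computable zero    = zero′ , λ _ → refl
const-computable (suc k) = suc-computable ∘-computable const-computable k

opaque
  unfolding pr

  -- Here `h` is any function satisfying the recursion equations, so functions defined natively,
  -- such as `fold` and `pred`, can be used unchanged. `u` and `v` supply the parameter and the
  -- counter.
  prec-computable : ∀ {f g u v} (h : ℕ → ℕ → ℕ) →
    (∀ a → h a 0 ≡ f a) → (∀ a n → h a (suc n) ≡ g (pr a (pr n (h a n)))) →
    f ComputableFrom X → g ComputableFrom X → u ComputableFrom X → v ComputableFrom X →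
    (λ x → h (u x) (v x)) ComputableFrom X
  prec-computable {X} {f} {g} {u} {v} h h-zero h-suc (c , p) (d , q) (cu , pu) (cv , pv) =
    comp (prec c d) (pair cu cv) ,
    λ x → _ , (_ , _ , pu x , pv x , refl) ,
      subst (λ ab → primRec (⟦ c ⟧ X) (⟦ d ⟧ X) (proj₁ ab) (proj₂ ab) (h (u x) (v x)))
            (sym (unpair-⟨,⟩ (u x) (v x))) (go (u x) (v x))
    where
    go : ∀ a n → primRec (⟦ c ⟧ X) (⟦ d ⟧ X) a n (h a n)
    go a zero    = subst (⟦ c ⟧ X a) (sym (h-zero a)) (p a)
    go a (suc n) = _ , go a n , subst (⟦ d ⟧ X _) (sym (h-suc a n)) (q _)

fold-computable : ∀ {s z n} → s ComputableFrom X → z ComputableFrom X → n ComputableFrom X →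
                  (λ x → fold (z x) s (n x)) ComputableFrom X
fold-computable {s = s} s-comp =
  prec-computable (λ z n → fold z s n) (λ _ → refl)
    (λ a n → cong s (sym (trans (cong R (R-pr a _)) (R-pr n _))))
    id-computable
    (s-comp ∘-computable R-computable ∘-computable R-computable)

pred-computable : ∀ {f} → f ComputableFrom X → (λ x → pred (f x)) ComputableFrom X
pred-computable =
  prec-computable (λ _ → pred) (λ _ → refl)
    (λ a n → sym (trans (cong L (R-pr a _)) (L-pr n _)))
    (const-computable 0) (L-computable ∘-computable R-computable) id-computable

∸-computable : ∀ {f} → f ComputableFrom X → ∀ k → (λ x → f x ∸ k) ComputableFrom X
∸-computable f-comp zero    = f-comp
∸-computable f-comp (suc k) =
  computable-cong (λ x → pred[m∸n]≡m∸[1+n] _ k) (pred-computable (∸-computable f-comp k))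

-- Tests throughout count zero as success, in keeping with `rfind`.
ifz : ℕ → ℕ → ℕ → ℕ
ifz zero    x y = x
ifz (suc _) x y = y

-- Recursion on the condition; the two branches are packed into the single parameter that `prec`
-- offers.
ifz-computable : ∀ {f g h} → f ComputableFrom X → g ComputableFrom X → h ComputableFrom X →
                 (λ x → ifz (f x) (g x) (h x)) ComputableFrom X
ifz-computable {f = f} {g} {h} f-comp g-comp h-comp =
  computable-cong (λ x → cong₂ (ifz (f x)) (L-pr (g x) (h x)) (R-pr (g x) (h x)))
    (prec-computable (λ a n → ifz n (L a) (R a)) (λ _ → refl)
      (λ a n → cong R (sym (L-pr a _)))
      L-computable (R-computable ∘-computable L-computable)
      (pr-computable g-comp h-comp) f-comp)

-- Supplies both halves of the `rfind` clause. Induction on the given zero, shifting `p` by one when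
-- `p 0` is nonzero.
least-zero : ∀ (p : ℕ → ℕ) n → p n ≡ 0 →
             ∃[ m ] (p m ≡ 0 × (∀ z → z < m → ∃[ w ] p z ≡ suc w))
least-zero p zero    eq = 0 , eq , λ _ ()
least-zero p (suc n) eq with p 0 in p0
... | zero  = 0 , p0 , λ _ ()
... | suc w with least-zero (p ∘ suc) n eq
...   | m , pm , below = suc m , pm , λ { zero _ → w , p0 ; (suc z) (s≤s z<m) → below z z<m }

opaque
  unfolding pr

  search-computable : ∀ {p} → p ComputableFrom X → (∀ x → ∃[ y ] p (pr x y) ≡ 0) →
    ∃[ m ] (m ComputableFrom X × (∀ x → p (pr x (m x)) ≡ 0))
  search-computable {X} {p} (c , c-correct) exists =
    (λ x → proj₁ (least x)) ,
    (rfind c , λ x → subst (⟦ c ⟧ X _) (proj₁ (proj₂ (least x))) (c-correct _) ,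
      λ z z<m → let w , eq = proj₂ (proj₂ (least x)) z z<m in w , subst (⟦ c ⟧ X _) eq (c-correct _)) ,
    λ x → proj₁ (proj₂ (least x))
    where
    least : ∀ x → ∃[ m ] (p (pr x m) ≡ 0 × (∀ z → z < m → ∃[ w ] p (pr x z) ≡ suc w))
    least x = let y , eq = exists x in least-zero (λ y → p (pr x y)) y eq

-- An abstract machine for programs

data Frame : Set where
  second   : Code → ℕ → Frame
  pairWith : ℕ → Frame
  apply    : Code → Frame
  recurse  : Code → ℕ → ℕ → Frame
  search   : Code → ℕ → ℕ → Frame

Stack : Set
Stack = List Frame

-- Frames are suspended work: `eval c x K` runs `c` on `x` and hands the result to `K`, while
-- `ret y K` delivers `y` to the top frame. With the control stack explicit, each step inspects only
-- the top of a finite object and can be carried out on code numbers.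
data State : Set where
  eval : Code → ℕ → Stack → State
  ret  : ℕ → Stack → State

-- Recursion is unwound from the top: the same program is evaluated at `pr a n`, and the frame then
-- applies `d` to the result.
evalPrec : Code → Code → ℕ → ℕ → Stack → State
evalPrec c d a zero    K = eval c a K
evalPrec c d a (suc n) K = eval (prec c d) (pr a n) (recurse d a n ∷ K)

continueSearch : Code → ℕ → ℕ → ℕ → Stack → State
continueSearch c x z zero    K = ret z K
continueSearch c x z (suc _) K = eval c (pr x (suc z)) (search c x (suc z) ∷ K)

step : (ℕ → ℕ) → State → State
step o (eval zero′ x K)           = ret 0 K
step o (eval succ x K)            = ret (suc x) K
step o (eval left x K)            = ret (L x) K
step o (eval right x K)           = ret (R x) K
step o (eval oracle x K)          = ret (o x) K
step o (eval (pair c d) x K)      = eval c x (second d x ∷ K)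
step o (eval (comp c d) x K)      = eval d x (apply c ∷ K)
step o (eval (prec c d) x K)      = evalPrec c d (L x) (R x) K
step o (eval (rfind c) x K)       = eval c (pr x 0) (search c x 0 ∷ K)
-- The final state is a fixed point, so a halted run stays halted under any larger step count.
step o (ret y [])                 = ret y []
step o (ret y (second d x ∷ K))   = eval d x (pairWith y ∷ K)
step o (ret y (pairWith u ∷ K))   = ret (pr u y) K
step o (ret y (apply c ∷ K))      = eval c y K
step o (ret y (recurse d a n ∷ K)) = eval d (pr a (pr n y)) K
step o (ret y (search c x z ∷ K)) = continueSearch c x z y K

run : (ℕ → ℕ) → ℕ → State → State
run o n s = fold s (step o) n

-- The machine takes a total function as oracle, whereas `χ X` is a relation; `characteristic`
-- obtains such a function from excluded middle.
Represents : (ℕ → ℕ) → Pred ℕ 0ℓ → Set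
Represents o X = ∀ n → χ X n (o n)

χ-unique : ∀ {n y z} → χ X n y → χ X n z → y ≡ z
χ-unique (inj₁ (_ , refl)) (inj₁ (_ , refl)) = refl
χ-unique (inj₁ (p , _))    (inj₂ (¬p , _))   = contradiction p ¬p
χ-unique (inj₂ (¬p , _))   (inj₁ (p , _))    = contradiction p ¬p
χ-unique (inj₂ (_ , refl)) (inj₂ (_ , refl)) = refl

-- Soundness and completeness of the machine for the relational semantics

module Soundness (X : Pred ℕ 0ℓ) (o : ℕ → ℕ) (o-χ : Represents o X) (c₀ : Code) (x₀ : ℕ) where

  NonzeroBelow : Code → ℕ → ℕ → Set
  NonzeroBelow c x z = ∀ z′ → z′ < z → ∃[ w ] ⟦ c ⟧ X (pr x z′) (suc w)

  -- Returning y to the stack can only lead to a final value of c₀ at x₀.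
  Accepts : Stack → ℕ → Set
  Accepts []                  y = ⟦ c₀ ⟧ X x₀ y
  Accepts (second d x ∷ K)    u = ∀ v → ⟦ d ⟧ X x v → Accepts K (pr u v)
  Accepts (pairWith u ∷ K)    v = Accepts K (pr u v)
  Accepts (apply c ∷ K)       u = ∀ y → ⟦ c ⟧ X u y → Accepts K y
  Accepts (recurse d a n ∷ K) r = ∀ y → ⟦ d ⟧ X (pr a (pr n r)) y → Accepts K y
  Accepts (search c x z ∷ K)  w =
    NonzeroBelow c x z × ⟦ c ⟧ X (pr x z) w × (∀ y → ⟦ rfind c ⟧ X x y → Accepts K y)

  -- Quantifying over the possible values of `c` at `x` avoids asking whether `c` halts there. The
  -- initial state satisfies this trivially, and at a final state it is the soundness claim.
  Invariant : State → Set
  Invariant (eval c x K) = ∀ y → ⟦ c ⟧ X x y → Accepts K y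
  Invariant (ret y K)    = Accepts K y

  opaque
    unfolding pr

    step-invariant : ∀ s → Invariant s → Invariant (step o s)
    step-invariant (eval zero′ x K)      I = I _ refl
    step-invariant (eval succ x K)       I = I _ refl
    step-invariant (eval left x K)       I = I _ refl
    step-invariant (eval right x K)      I = I _ refl
    step-invariant (eval oracle x K)     I = I _ (o-χ x)
    step-invariant (eval (pair c d) x K) I u p v q = I _ (_ , _ , p , q , refl)
    step-invariant (eval (comp c d) x K) I u p y q = I _ (_ , p , q)
    step-invariant (eval (prec c d) x K) I with unpair x
    ... | a , zero  = I
    -- `r` is the value at `n` and `q` leads from it to the value at `suc n`. Since `prec` unpairs
    -- its input, the graph at `pr a n` is transported along `unpair-⟨,⟩`.
    ... | a , suc n = λ r p y q →
      I y (r , subst (λ ab → primRec (⟦ c ⟧ X) (⟦ d ⟧ X) (proj₁ ab) (proj₂ ab) r) (unpair-⟨,⟩ a n) p , q)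
    step-invariant (eval (rfind c) x K)  I w p = (λ _ ()) , p , I
    step-invariant (ret y [])                  I = I
    step-invariant (ret y (second d x ∷ K))    I = I
    step-invariant (ret y (pairWith u ∷ K))    I = I
    step-invariant (ret y (apply c ∷ K))       I = I
    step-invariant (ret y (recurse d a n ∷ K)) I = I
    -- A zero at `z` completes the `rfind` clause together with `below`; a nonzero value extends
    -- `below` by the point `z` itself.
    step-invariant (ret zero (search c x z ∷ K))    (below , p , J) = J z (p , below)
    step-invariant (ret (suc w) (search c x z ∷ K)) (below , p , J) v q = below′ , q , J
      where
      below′ : NonzeroBelow c x (suc z)
      below′ z′ (s≤s z′≤z) with m≤n⇒m<n∨m≡n z′≤z
      ... | inj₁ z′<z = below z′ z′<z
      ... | inj₂ refl = w , p

  run-invariant : ∀ n → Invariant (run o n (eval c₀ x₀ []))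
  run-invariant zero    = λ _ → id
  run-invariant (suc n) = step-invariant (run o n (eval c₀ x₀ [])) (run-invariant n)

  sound : ∀ n {y} → run o n (eval c₀ x₀ []) ≡ ret y [] → ⟦ c₀ ⟧ X x₀ y
  sound n eq = subst Invariant eq (run-invariant n)

module Completeness (X : Pred ℕ 0ℓ) (o : ℕ → ℕ) (o-χ : Represents o X) where

  infix 4 _⟶*_

  _⟶*_ : State → State → Set
  s ⟶* t = ∃[ n ] run o n s ≡ t

  ⟶*-trans : ∀ {s t u} → s ⟶* t → t ⟶* u → s ⟶* u
  ⟶*-trans {s} (m , refl) (n , refl) = n + m , fold-+ s (step o) n

  step-⟶* : ∀ s {t u} → step o s ≡ t → t ⟶* u → s ⟶* u
  step-⟶* s eq = ⟶*-trans (1 , eq)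

  opaque
    unfolding pr

    -- Structural induction on `c`; the arbitrary stack `K` lets the hypotheses apply to subprograms
    -- run under pushed frames.
    complete : ∀ c {x y} K → ⟦ c ⟧ X x y → eval c x K ⟶* ret y K
    complete zero′  K refl = 1 , refl
    complete succ   K refl = 1 , refl
    complete left   K refl = 1 , refl
    complete right  K refl = 1 , refl
    complete oracle K p    = 1 , cong (λ y → ret y K) (χ-unique {X} (o-χ _) p)
    complete (pair c d) K (u , v , p , q , refl) =
      step-⟶* _ refl (⟶*-trans (complete c _ p)
        (step-⟶* _ refl (⟶*-trans (complete d _ q) (1 , refl))))
    complete (comp c d) K (u , p , q) =
      step-⟶* _ refl (⟶*-trans (complete d _ p) (step-⟶* _ refl (complete c K q)))
    complete (prec c d) {x} {y} K p =
      go x (proj₁ (unpair x)) (proj₂ (unpair x)) y K refl p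
      where
      -- Induction on the counter `n`, with the input generalised because the recursive run starts
      -- from `⟨ a , n ⟩`.
      go : ∀ x a n y K → unpair x ≡ (a , n) → primRec (⟦ c ⟧ X) (⟦ d ⟧ X) a n y →
           eval (prec c d) x K ⟶* ret y K
      go x a zero    y K eq p =
        step-⟶* _ (cong (λ ab → evalPrec c d (proj₁ ab) (proj₂ ab) K) eq) (complete c K p)
      go x a (suc n) y K eq (r , p , q) =
        step-⟶* _ (cong (λ ab → evalPrec c d (proj₁ ab) (proj₂ ab) K) eq)
          (⟶*-trans (go ⟨ a , n ⟩ a n r _ (unpair-⟨,⟩ a n) p)
            (step-⟶* _ refl (complete d K q)))
    complete (rfind c) {x} {y} K (p , below) = step-⟶* _ refl (go y 0 (+-identityʳ y))
      where
      -- `k` counts the candidates still to be rejected before the search reaches `y`.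
      go : ∀ k z → k + z ≡ y → eval c ⟨ x , z ⟩ (search c x z ∷ K) ⟶* ret y K
      go zero    z refl = ⟶*-trans (complete c _ p) (1 , refl)
      go (suc k) z eq   =
        let w , q = below z (subst (z <_) eq (s≤s (m≤n+m z k))) in
        ⟶*-trans (complete c _ q) (step-⟶* _ refl (go k (suc z) (trans (+-suc k z) eq)))

-- The machine on code numbers

-- Tags up to 7 pass the test and advance by one with the argument kept; tag 8 returns to 5 with the
-- next argument, matching the residue classes used by `encode`.
nodeStep : ℕ → ℕ
nodeStep s = ifz (L s ∸ 7) (pr (suc (L s)) (R s)) (pr 5 (suc (R s)))

opaque
  -- node (encode c) is the pair of the constructor of c (numbered 0 to 8) and
  -- its argument; the four compound constructors are counted off cyclically.
  node : ℕ → ℕ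
  node = fold (pr 0 0) nodeStep

  node-zero : node 0 ≡ pr 0 0
  node-zero = refl

  -- Stated for a known pair so that applications chain: for a concrete tag `t` the test `t ∸ 7`
  -- reduces by itself.
  node-suc : ∀ n {t p} → node n ≡ pr t p →
             node (suc n) ≡ ifz (t ∸ 7) (pr (suc t) p) (pr 5 (suc p))
  node-suc n {t} {p} eq rewrite eq | L-pr t p | R-pr t p = refl

  node-computable : ∀ {f} → f ComputableFrom X → (λ x → node (f x)) ComputableFrom X
  node-computable =
    fold-computable
      (ifz-computable (∸-computable L-computable 7)
        (pr-computable (suc-computable ∘-computable L-computable) R-computable)
        (pr-computable (const-computable 5) (suc-computable ∘-computable R-computable)))
      (const-computable (pr 0 0))

-- Raising `p` by one goes once round the tags 5, 6, 7, 8, which takes four uses of `node-suc`; the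
-- base case climbs past the five atoms.
node-pair : ∀ p → node (5 + 4 * p) ≡ pr 5 p
node-pair zero = node-suc 4 (node-suc 3 (node-suc 2 (node-suc 1 (node-suc 0 node-zero))))
node-pair (suc p) =
  trans (cong (node ∘ (5 +_)) (*-suc 4 p))
    (node-suc (8 + 4 * p) (node-suc (7 + 4 * p) (node-suc (6 + 4 * p) (node-suc (5 + 4 * p) (node-pair p)))))

node-comp : ∀ p → node (6 + 4 * p) ≡ pr 6 p
node-comp p = node-suc (5 + 4 * p) (node-pair p)

node-prec : ∀ p → node (7 + 4 * p) ≡ pr 7 p
node-prec p = node-suc (6 + 4 * p) (node-comp p)

node-rfind : ∀ p → node (8 + 4 * p) ≡ pr 8 p
node-rfind p = node-suc (7 + 4 * p) (node-prec p)

-- The first component of a coded state is 0 for a returning state and the successor of the program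
-- number for an evaluating one.
evalN : (e v k : ℕ) → ℕ
evalN e v k = pr (suc e) (pr v k)

retN : (y k : ℕ) → ℕ
retN y k = pr 0 (pr y k)

-- All frames share one format: a tag, a program number and two numbers, with 0 for absent fields.
-- The successor keeps nonempty stacks apart from the empty stack 0.
pushN : (t c a n k : ℕ) → ℕ
pushN t c a n k = suc (pr (pr t (pr c (pr a n))) k)

-- `t` and `p` are the constructor tag and argument of program `e`. Once the earlier tests have
-- failed, `t ∸ i` vanishes exactly when `t` is `i`. The number `e` is kept for `prec`, which
-- evaluates itself again.
stepNode : (ℕ → ℕ) → (t p e v k : ℕ) → ℕ
stepNode o t p e v k =
  ifz t       (retN 0 k)
 (ifz (t ∸ 1) (retN (suc v) k)
 (ifz (t ∸ 2) (retN (L v) k)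
 (ifz (t ∸ 3) (retN (R v) k)
 (ifz (t ∸ 4) (retN (o v) k)
 (ifz (t ∸ 5) (evalN (L p) v (pushN 0 (R p) v 0 k))
 (ifz (t ∸ 6) (evalN (R p) v (pushN 2 (L p) 0 0 k))
 (ifz (t ∸ 7) (ifz (R v) (evalN (L p) (L v) k)
                (evalN e (pr (L v) (pred (R v))) (pushN 3 (R p) (L v) (pred (R v)) k)))
              (evalN p (pr v 0) (pushN 4 p v 0 k)))))))))

stepEval : (ℕ → ℕ) → (e v k : ℕ) → ℕ
stepEval o e v k = stepNode o (L (node e)) (R (node e)) e v k

stepFrame : (t c a n y k : ℕ) → ℕ
stepFrame t c a n y k =
  ifz t       (evalN c a (pushN 1 0 y 0 k))
 (ifz (t ∸ 1) (retN (pr a y) k)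
 (ifz (t ∸ 2) (evalN c y k)
 (ifz (t ∸ 3) (evalN c (pr a (pr n y)) k)
 (ifz y (retN n k) (evalN c (pr a (suc n)) (pushN 4 c a (suc n) k))))))

stepRet : (y k : ℕ) → ℕ
stepRet y k =
  ifz k (retN y 0) (stepFrame (L f) (L (R f)) (L (R (R f))) (R (R (R f))) y (R (pred k)))
  where
  f : ℕ
  f = L (pred k)

stepN : (ℕ → ℕ) → ℕ → ℕ
stepN o s = ifz (L s) (stepRet (L (R s)) (R (R s))) (stepEval o (pred (L s)) (L (R s)) (R (R s)))

encodeStack : Stack → ℕ
encodeStack []                  = 0
encodeStack (second d x ∷ K)    = pushN 0 (encode d) x 0 (encodeStack K)
encodeStack (pairWith u ∷ K)    = pushN 1 0 u 0 (encodeStack K)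
encodeStack (apply c ∷ K)       = pushN 2 (encode c) 0 0 (encodeStack K)
encodeStack (recurse d a n ∷ K) = pushN 3 (encode d) a n (encodeStack K)
encodeStack (search c x z ∷ K)  = pushN 4 (encode c) x z (encodeStack K)

encodeState : State → ℕ
encodeState (eval c x K) = evalN (encode c) x (encodeStack K)
encodeState (ret y K)    = retN y (encodeStack K)

stepN-eval : ∀ o e v k → stepN o (evalN e v k) ≡ stepEval o e v k
stepN-eval o e v k
  rewrite L-pr (suc e) (pr v k) | R-pr (suc e) (pr v k) | L-pr v k | R-pr v k = refl

stepN-ret : ∀ o y k → stepN o (retN y k) ≡ stepRet y k
stepN-ret o y k
  rewrite L-pr 0 (pr y k) | R-pr 0 (pr y k) | L-pr y k | R-pr y k = refl

stepRet-push : ∀ t c a n y k → stepRet y (pushN t c a n k) ≡ stepFrame t c a n y k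
stepRet-push t c a n y k
  rewrite L-pr (pr t (pr c (pr a n))) k | R-pr (pr t (pr c (pr a n))) k
        | L-pr t (pr c (pr a n)) | R-pr t (pr c (pr a n))
        | L-pr c (pr a n) | R-pr c (pr a n) | L-pr a n | R-pr a n = refl

stepEval-node : ∀ o e v k {t p} → node e ≡ pr t p → stepEval o e v k ≡ stepNode o t p e v k
stepEval-node o e v k {t} {p} eq rewrite eq | L-pr t p | R-pr t p = refl

opaque
  unfolding pr

  -- Connects the transparent pairing in `encode` with the opaque `pr`, for which the projection
  -- laws are stated.
  encode-pr : ∀ c d → ⟨ encode c , encode d ⟩ ≡ pr (encode c) (encode d)
  encode-pr c d = refl

stepN-frame : ∀ o t c a n y k → stepN o (retN y (pushN t c a n k)) ≡ stepFrame t c a n y k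
stepN-frame o t c a n y k = trans (stepN-ret o y _) (stepRet-push t c a n y k)

stepN-node : ∀ o e v k {t p} → node e ≡ pr t p → stepN o (evalN e v k) ≡ stepNode o t p e v k
stepN-node o e v k eq = trans (stepN-eval o e v k) (stepEval-node o e v k eq)

-- One coded step corresponds to exactly one machine step, so step counts carry over unchanged.
stepN-encode : ∀ o s → stepN o (encodeState s) ≡ encodeState (step o s)
stepN-encode o (eval zero′ x K)  = stepN-node o 0 x _ node-zero
stepN-encode o (eval succ x K)   = stepN-node o 1 x _ (node-suc 0 node-zero)
stepN-encode o (eval left x K)   = stepN-node o 2 x _ (node-suc 1 (node-suc 0 node-zero))
stepN-encode o (eval right x K)  = stepN-node o 3 x _ (node-suc 2 (node-suc 1 (node-suc 0 node-zero)))
stepN-encode o (eval oracle x K) =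
  stepN-node o 4 x _ (node-suc 3 (node-suc 2 (node-suc 1 (node-suc 0 node-zero))))
stepN-encode o (eval (pair c d) x K)
  rewrite stepN-node o (encode (pair c d)) x (encodeStack K) (node-pair ⟨ encode c , encode d ⟩)
        | encode-pr c d | L-pr (encode c) (encode d) | R-pr (encode c) (encode d) = refl
stepN-encode o (eval (comp c d) x K)
  rewrite stepN-node o (encode (comp c d)) x (encodeStack K) (node-comp ⟨ encode c , encode d ⟩)
        | encode-pr c d | L-pr (encode c) (encode d) | R-pr (encode c) (encode d) = refl
stepN-encode o (eval (prec c d) x K) =
  trans (stepN-node o (encode (prec c d)) x _ (node-prec ⟨ encode c , encode d ⟩))
    (go (R x) _ (trans (cong L (encode-pr c d)) (L-pr _ _)) (trans (cong R (encode-pr c d)) (R-pr _ _)))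
  where
  k : ℕ
  k = encodeStack K

  -- `R x` and the code of the pair are generalised to `n` and `p`; splitting on `n` then makes
  -- `ifz` and `evalPrec` reduce together.
  go : ∀ n p → L p ≡ encode c → R p ≡ encode d →
       ifz n (evalN (L p) (L x) k)
         (evalN (encode (prec c d)) (pr (L x) (pred n)) (pushN 3 (R p) (L x) (pred n) k))
       ≡ encodeState (evalPrec c d (L x) n K)
  go zero    p eqL eqR rewrite eqL = refl
  go (suc n) p eqL eqR rewrite eqR = refl
stepN-encode o (eval (rfind c) x K) = stepN-node o (encode (rfind c)) x _ (node-rfind (encode c))
stepN-encode o (ret y [])                  = stepN-ret o y 0
stepN-encode o (ret y (second d x ∷ K))    = stepN-frame o 0 (encode d) x 0 y (encodeStack K)
stepN-encode o (ret y (pairWith u ∷ K))    = stepN-frame o 1 0 u 0 y (encodeStack K)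
stepN-encode o (ret y (apply c ∷ K))       = stepN-frame o 2 (encode c) 0 0 y (encodeStack K)
stepN-encode o (ret y (recurse d a n ∷ K)) = stepN-frame o 3 (encode d) a n y (encodeStack K)
stepN-encode o (ret zero (search c x z ∷ K))    = stepN-frame o 4 (encode c) x z 0 (encodeStack K)
stepN-encode o (ret (suc w) (search c x z ∷ K)) = stepN-frame o 4 (encode c) x z (suc w) (encodeStack K)

-- Computability of the coded step function

evalN-computable : ∀ {e v k} → e ComputableFrom X → v ComputableFrom X → k ComputableFrom X →
                   (λ x → evalN (e x) (v x) (k x)) ComputableFrom X
evalN-computable e v k = pr-computable (suc-computable ∘-computable e) (pr-computable v k)

retN-computable : ∀ {y k} → y ComputableFrom X → k ComputableFrom X →
                  (λ x → retN (y x) (k x)) ComputableFrom X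
retN-computable y k = pr-computable (const-computable 0) (pr-computable y k)

pushN-computable : ∀ t {c a n k} → c ComputableFrom X → a ComputableFrom X →
                   n ComputableFrom X → k ComputableFrom X →
                   (λ x → pushN t (c x) (a x) (n x) (k x)) ComputableFrom X
pushN-computable t c a n k =
  suc-computable ∘-computable
    pr-computable (pr-computable (const-computable t) (pr-computable c (pr-computable a n))) k

stepNode-computable : ∀ {o t p e v k} → o ComputableFrom X →
  t ComputableFrom X → p ComputableFrom X → e ComputableFrom X → v ComputableFrom X →
  k ComputableFrom X → (λ x → stepNode o (t x) (p x) (e x) (v x) (k x)) ComputableFrom X
stepNode-computable o t p e v k =
  ifz-computable t (retN-computable (const-computable 0) k)
 (ifz-computable (∸-computable t 1) (retN-computable (suc-computable ∘-computable v) k)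
 (ifz-computable (∸-computable t 2) (retN-computable (L-computable ∘-computable v) k)
 (ifz-computable (∸-computable t 3) (retN-computable (R-computable ∘-computable v) k)
 (ifz-computable (∸-computable t 4) (retN-computable (o ∘-computable v) k)
 (ifz-computable (∸-computable t 5)
   (evalN-computable Lp v (pushN-computable 0 Rp v (const-computable 0) k))
 (ifz-computable (∸-computable t 6)
   (evalN-computable Rp v (pushN-computable 2 Lp (const-computable 0) (const-computable 0) k))
 (ifz-computable (∸-computable t 7)
   (ifz-computable Rv (evalN-computable Lp Lv k)
     (evalN-computable e (pr-computable Lv (pred-computable Rv))
       (pushN-computable 3 Rp Lv (pred-computable Rv) k)))
   (evalN-computable p (pr-computable v (const-computable 0))
     (pushN-computable 4 p v (const-computable 0) k)))))))))
  where
  Lp = L-computable ∘-computable p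
  Rp = R-computable ∘-computable p
  Lv = L-computable ∘-computable v
  Rv = R-computable ∘-computable v

stepFrame-computable : ∀ {t c a n y k} →
  t ComputableFrom X → c ComputableFrom X → a ComputableFrom X → n ComputableFrom X →
  y ComputableFrom X → k ComputableFrom X →
  (λ x → stepFrame (t x) (c x) (a x) (n x) (y x) (k x)) ComputableFrom X
stepFrame-computable t c a n y k =
  ifz-computable t
    (evalN-computable c a (pushN-computable 1 (const-computable 0) y (const-computable 0) k))
 (ifz-computable (∸-computable t 1) (retN-computable (pr-computable a y) k)
 (ifz-computable (∸-computable t 2) (evalN-computable c y k)
 (ifz-computable (∸-computable t 3) (evalN-computable c (pr-computable a (pr-computable n y)) k)
 (ifz-computable y (retN-computable n k)
   (evalN-computable c (pr-computable a sn) (pushN-computable 4 c a sn k))))))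
  where
  sn = suc-computable ∘-computable n

stepN-computable : ∀ {o} → o ComputableFrom X → stepN o ComputableFrom X
stepN-computable o =
  ifz-computable L-computable
    (ifz-computable k (retN-computable v (const-computable 0))
      (stepFrame-computable
        (L-computable ∘-computable frame)
        (L-computable ∘-computable R-computable ∘-computable frame)
        (L-computable ∘-computable R-computable ∘-computable R-computable ∘-computable frame)
        (R-computable ∘-computable R-computable ∘-computable R-computable ∘-computable frame)
        v (R-computable ∘-computable pred-computable k)))
    (stepNode-computable o (L-computable ∘-computable nd) (R-computable ∘-computable nd) e v k)
  where
  v = L-computable ∘-computable R-computable
  k = R-computable ∘-computable R-computable
  e = pred-computable L-computable
  nd = node-computable e
  frame = L-computable ∘-computable pred-computable k

-- Bounded runs of the coded machine and halting

runN : (ℕ → ℕ) → (n e x : ℕ) → ℕ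
runN o n e x = fold (evalN e x 0) (stepN o) n

runN-computable : ∀ {o n e v} → o ComputableFrom X →
  n ComputableFrom X → e ComputableFrom X → v ComputableFrom X →
  (λ x → runN o (n x) (e x) (v x)) ComputableFrom X
runN-computable o n e v =
  fold-computable (stepN-computable o) (evalN-computable e v (const-computable 0)) n

runN-encode : ∀ o n c x → runN o n (encode c) x ≡ encodeState (run o n (eval c x []))
runN-encode o zero    c x = refl
runN-encode o (suc n) c x =
  trans (cong (stepN o) (runN-encode o n c x)) (stepN-encode o (run o n (eval c x [])))

-- A zero test for final states: on a returning state the stack code itself is the answer, being 0
-- only for the empty stack, and 1 stands for a program still being evaluated.
stop : ℕ → ℕ
stop s = ifz (L s) (R (R s)) 1

stop-computable : ∀ {f} → f ComputableFrom X → (λ x → stop (f x)) ComputableFrom X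
stop-computable f =
  ifz-computable (L-computable ∘-computable f) (R-computable ∘-computable R-computable ∘-computable f)
    (const-computable 1)

-- The output of a halted run. On other states it is still some number, a default that keeps the
-- function `f` of the theorem total.
value : ℕ → ℕ
value s = L (R s)

stop-ret : ∀ y k → stop (retN y k) ≡ k
stop-ret y k rewrite L-pr 0 (pr y k) | R-pr 0 (pr y k) | R-pr y k = refl

value-ret : ∀ y k → value (retN y k) ≡ y
value-ret y k rewrite R-pr 0 (pr y k) | L-pr y k = refl

encodeStack-zero : ∀ K → encodeStack K ≡ 0 → K ≡ []
encodeStack-zero [] _ = refl
encodeStack-zero (second _ _ ∷ _) ()
encodeStack-zero (pairWith _ ∷ _) ()
encodeStack-zero (apply _ ∷ _) ()
encodeStack-zero (recurse _ _ _ ∷ _) ()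
encodeStack-zero (search _ _ _ ∷ _) ()

stop-zero : ∀ s → stop (encodeState s) ≡ 0 → ∃[ y ] s ≡ ret y []
stop-zero (eval c x K) eq rewrite L-pr (suc (encode c)) (pr x (encodeStack K)) with () ← eq
stop-zero (ret y K)    eq =
  y , cong (ret y) (encodeStack-zero K (trans (sym (stop-ret y (encodeStack K))) eq))

Halts : (ℕ → ℕ) → (n : ℕ) → Code → (x y : ℕ) → Set
Halts o n c x y = run o n (eval c x []) ≡ ret y []

stop⇒Halts : ∀ o n c x → stop (runN o n (encode c) x) ≡ 0 → ∃[ y ] Halts o n c x y
stop⇒Halts o n c x eq = stop-zero _ (trans (cong stop (sym (runN-encode o n c x))) eq)

Halts⇒stop : ∀ o n c x {y} → Halts o n c x y → stop (runN o n (encode c) x) ≡ 0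
Halts⇒stop o n c x h =
  trans (cong stop (trans (runN-encode o n c x) (cong encodeState h))) (stop-ret _ 0)

Halts⇒value : ∀ o n c x {y} → Halts o n c x y → value (runN o n (encode c) x) ≡ y
Halts⇒value o n c x h =
  trans (cong value (trans (runN-encode o n c x) (cong encodeState h))) (value-ret _ 0)

run-ret : ∀ o n {y} → run o n (ret y []) ≡ ret y []
run-ret o zero    = refl
run-ret o (suc n) = cong (step o) (run-ret o n)

Halts-mono : ∀ o {m n c x y} → m ≤ n → Halts o m c x y → Halts o n c x y
Halts-mono o {m} {n} {c} {x} {y} m≤n h = subst (λ k → Halts o k c x y) (m∸n+n≡m m≤n)
  (trans (fold-+ _ (step o) (n ∸ m)) (trans (cong (run o (n ∸ m)) h) (run-ret o (n ∸ m))))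

ret-injective : ∀ {y z K} → ret y K ≡ ret z K → y ≡ z
ret-injective refl = refl

-- The shorter run is already final, so by monotonicity the longer one ends in the same state.
Halts-unique : ∀ o {m n c x y z} → Halts o m c x y → Halts o n c x z → y ≡ z
Halts-unique o {m} {n} {c} {x} h h′ with ≤-total m n
... | inj₁ m≤n = ret-injective (trans (sym (Halts-mono o {c = c} {x} m≤n h)) h′)
... | inj₂ n≤m = ret-injective (trans (sym h) (Halts-mono o {c = c} {x} n≤m h′))

-- Characteristic functions and Turing reducibility

characteristic : ExcludedMiddle 0ℓ → (X : Pred ℕ 0ℓ) → ∃[ o ] Represents o X
characteristic em X = proj₁ ∘ decide , proj₂ ∘ decide
  where
  decide : ∀ n → ∃[ y ] χ X n y
  decide n with em {X n}
  ... | yes p = 1 , inj₁ (p , refl)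
  ... | no ¬p = 0 , inj₂ (¬p , refl)

≤T⇒computable : ∀ {A X o} → Represents o A → A ≤T X → o ComputableFrom X
≤T⇒computable {A} {X} o-χ (c , p) = c , λ n →
  let y , q , r = p n in subst (⟦ c ⟧ X n) (χ-unique {A} r (o-χ n)) q

computable⇒≤T : ∀ {A X o} → Represents o A → o ComputableFrom X → A ≤T X
computable⇒≤T o-χ (c , p) = c , λ n → _ , p n , o-χ n

empty : ℕ → ℕ
empty _ = 0

empty-χ : Represents empty ∅
empty-χ n = inj₂ (id , refl)

-- The function `f` and the decision of `∅′` from `X`

theorem6 : ExcludedMiddle 0ℓ →
    (X : Pred ℕ 0ℓ) → Δ⁰₂-Set X → ¬ (∅′ ≤T X) →
    ∃[ f ] (Δ⁰₂-Function f ×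
    ¬ (∃[ g ] (g ComputableFrom X × g IsDiagonalizingFor f)))
theorem6 em X X≤∅′ ∅′≰X = f , f-computable , λ (g , g-comp , diag) → no-diagonalization g g-comp diag
  where
  o : ℕ → ℕ
  o = proj₁ (characteristic em X)

  o-χ : Represents o X
  o-χ = proj₂ (characteristic em X)

  j : ℕ → ℕ
  j = proj₁ (characteristic em ∅′)

  j-χ : Represents j ∅′
  j-χ = proj₂ (characteristic em ∅′)

  open Completeness using (complete)
  open Soundness using (sound)

  -- A stagewise approximation of `∅′`: program and input are the same number, as in `jump`, and a
  -- zero at stage `s` certifies membership.
  selfStop : ℕ → ℕ → ℕ
  selfStop n s = stop (runN empty s n n)

  selfStop-computable : ∀ {Y n s} → n ComputableFrom Y → s ComputableFrom Y →
                        (λ x → selfStop (n x) (s x)) ComputableFrom Y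
  selfStop-computable n s = stop-computable (runN-computable (const-computable 0) s n n)

  selfStop-∈ : ∀ {n s} → selfStop n s ≡ 0 → ∅′ n
  selfStop-∈ {n} {s} eq with encode-surjective n
  ... | c , refl = let y , h = stop⇒Halts empty s c n eq in
    c , refl , y , sound ∅ empty empty-χ c n s h

  ∈-selfStop : ∀ {n} → ∅′ n → ∃[ s ] selfStop n s ≡ 0
  ∈-selfStop {n} (c , refl , y , p) =
    let s , h = complete ∅ empty empty-χ c [] p in s , Halts⇒stop empty s c n h

  selfStop-mono : ∀ {n s t} → s ≤ t → selfStop n s ≡ 0 → selfStop n t ≡ 0
  selfStop-mono {n} {s} {t} s≤t eq with encode-surjective n
  ... | c , refl = let y , h = stop⇒Halts empty s c n eq in
    Halts⇒stop empty t c n (Halts-mono empty {c = c} {n} s≤t h)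

  -- Outside `∅′` the test succeeds at once, so the search for a stage is total; `j`, computed by
  -- the oracle `∅′`, tells the two cases apart.
  stageTest : ℕ → ℕ
  stageTest w = ifz (j (L w)) 0 (selfStop (L w) (R w))

  stageTest-pr : ∀ n s → stageTest (pr n s) ≡ ifz (j n) 0 (selfStop n s)
  stageTest-pr n s = cong₂ (λ n s → ifz (j n) 0 (selfStop n s)) (L-pr n s) (R-pr n s)

  j-computable : j ComputableFrom ∅′
  j-computable = oracle , j-χ

  stage-exists : ∀ n → ∃[ s ] stageTest (pr n s) ≡ 0
  stage-exists n with j n | j-χ n | stageTest-pr n
  ... | _ | inj₁ (n∈∅′ , refl) | eq = let s , p = ∈-selfStop n∈∅′ in s , trans (eq s) p
  ... | _ | inj₂ (_ , refl)    | eq = 0 , eq 0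

  stage-search : ∃[ τ ] (τ ComputableFrom ∅′ × (∀ n → stageTest (pr n (τ n)) ≡ 0))
  stage-search = search-computable
    (ifz-computable (j-computable ∘-computable L-computable) (const-computable 0)
      (selfStop-computable L-computable R-computable))
    stage-exists

  τ : ℕ → ℕ
  τ = proj₁ stage-search

  τ-stop : ∀ {n} → ∅′ n → selfStop n (τ n) ≡ 0
  τ-stop {n} n∈∅′ = trans
    -- Membership of `n` forces `j n` to be 1, which selects the `selfStop` branch of the test.
    (cong (λ b → ifz b 0 (selfStop n (τ n))) (χ-unique {∅′} (inj₁ (n∈∅′ , refl)) (j-χ n)))
    (trans (sym (stageTest-pr n (τ n))) (proj₂ (proj₂ stage-search) n))

  f : ℕ → ℕ
  f x = value (runN o (τ (R x)) (L x) x)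

  f-computable : f ComputableFrom ∅′
  f-computable = L-computable ∘-computable R-computable ∘-computable
    -- Since `X` is computable from `∅′`, a machine with oracle `X` can be simulated using `∅′`.
    runN-computable (≤T⇒computable o-χ X≤∅′) (proj₁ (proj₂ stage-search) ∘-computable R-computable)
      L-computable id-computable

  f-pr : ∀ e n → f (pr e n) ≡ value (runN o (τ n) e (pr e n))
  f-pr e n = cong₂ (λ n′ e′ → value (runN o (τ n′) e′ (pr e n))) (R-pr e n) (L-pr e n)

  no-diagonalization : ∀ g → g ComputableFrom X → ¬ (g IsDiagonalizingFor f)
  no-diagonalization g (c , p) diag = ∅′≰X (computable⇒≤T {∅′} r-χ r-computable)
    where
    e : ℕ
    e = encode c

    timeTest : ℕ → ℕ
    timeTest w = stop (runN o (R w) e (pr e (L w)))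

    timeTest-pr : ∀ n t → timeTest (pr n t) ≡ stop (runN o t e (pr e n))
    timeTest-pr n t = cong₂ (λ n t → stop (runN o t e (pr e n))) (L-pr n t) (R-pr n t)

    halts : ∀ n → ∃[ t ] Halts o t c (pr e n) (g (pr e n))
    halts n = complete X o o-χ c [] (p (pr e n))

    o-computable : o ComputableFrom X
    o-computable = oracle , o-χ

    time-search : ∃[ σ ] (σ ComputableFrom X × (∀ n → timeTest (pr n (σ n)) ≡ 0))
    time-search = search-computable
      (stop-computable (runN-computable o-computable R-computable (const-computable e)
        (pr-computable (const-computable e) L-computable)))
      (λ n → let t , h = halts n in
        t , trans (timeTest-pr n t) (Halts⇒stop o t c (pr e n) h))

    σ : ℕ → ℕ
    σ = proj₁ time-search

    -- The search only shows that the run stops by `σ n`; uniqueness of outputs identifies its value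
    -- with that of `g`.
    σ-halts : ∀ n → Halts o (σ n) c (pr e n) (g (pr e n))
    σ-halts n =
      let y , h = stop⇒Halts o (σ n) c (pr e n)
                    (trans (sym (timeTest-pr n (σ n))) (proj₂ (proj₂ time-search) n))
          t , h′ = halts n
      in subst (Halts o (σ n) c (pr e n)) (Halts-unique o {σ n} {t} {c} {pr e n} h h′) h

    r : ℕ → ℕ
    r n = ifz (selfStop n (σ n)) 1 0

    r-computable : r ComputableFrom X
    r-computable =
      ifz-computable (selfStop-computable id-computable (proj₁ (proj₂ time-search)))
        (const-computable 1) (const-computable 0)

    -- Otherwise `τ n` steps would suffice for the run of `c` to halt, and `f` would take the value
    -- of `g` at `pr e n`, against `diag`.
    τ≤σ : ∀ n → τ n ≤ σ n
    τ≤σ n = [ id , (λ σ≤τ → contradiction (agree σ≤τ) (diag (pr e n))) ]′ (≤-total (τ n) (σ n))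
      where
      agree : σ n ≤ τ n → g (pr e n) ≡ f (pr e n)
      agree σ≤τ = sym (trans (f-pr e n)
        (Halts⇒value o (τ n) c (pr e n) (Halts-mono o {c = c} {pr e n} σ≤τ (σ-halts n))))

    r-χ : Represents r ∅′
    r-χ n = go (selfStop n (σ n)) refl
      where
      go : ∀ b → selfStop n (σ n) ≡ b → χ ∅′ n (ifz b 1 0)
      go zero    eq = inj₁ (selfStop-∈ {n} {σ n} eq , refl)
      -- A member of `∅′` has halted by stage `τ n`, hence by the later stage `σ n`, so a nonzero
      -- test there excludes membership.
      go (suc _) eq = inj₂ ((λ n∈∅′ →
        1+n≢0 (trans (sym eq) (selfStop-mono {n} (τ≤σ n) (τ-stop n∈∅′)))) , refl)
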